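{- Let $p$ be a prime and $k,\ell$ integers with $k>0$, $\ell\ge0$; put $q=p^k$ and $Q=p^{\ell}$. Let $c\in\mathbb{F}_{q^3}$ and define \[ f(X)=(X^q-X)^3+c^{q^2}X^{q^2Q}+c^qX^{qQ}+cX^{Q}, \] i.e. $f(X)=X^3\circ(X^q-X)+(X^{q^2}+X^q+X)\circ cX^Q$. Then $f(X)$ permutes $\mathbb{F}_{q^3}$ if and only if $q\equiv 2\pmod 3$ and $c^{q^2}+c^q+c\ne 0$.
   Context: A polynomial permutes $\mathbb{F}_{q^3}$ if the induced map $\mathbb{F}_{q^3}\to\mathbb{F}_{q^3}$ is a bijection. -}

module Defs where

open import Algebra.Apartness.Bundles using (HeytingCommutativeRing; HeytingField)
open import Algebra.Bundles using (CommutativeRing)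
open import Data.Fin.Base using (Fin)
open import Data.List.Base using (List; []; _∷_; _++_; map; replicate; foldr)
open import Data.Nat.Base as ℕ using (ℕ; zero; suc)
open import Function.Bundles using (Inverse)
open import Function.Definitions using (Bijective)
open import Level using (Level; _⊔_)
open import Relation.Binary.PropositionalEquality using (setoid)

-- Polynomials are coefficient lists, constant term first; trailing zeros are
-- allowed, so one polynomial has many representatives, all with the same
-- evaluation map.
module Polynomials {a ℓ : Level} (R : CommutativeRing a ℓ) where

  open CommutativeRing R

  Poly : Set a
  Poly = List Carrier

  infixl 6 _+ᴾ_ _-ᴾ_
  infixl 7 _*ᴾ_
  infixr 8 _^ᴾ_ _X^_

  _+ᴾ_ : Poly → Poly → Poly
  []       +ᴾ g        = g
  (x ∷ f)  +ᴾ []       = x ∷ f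
  (x ∷ f)  +ᴾ (y ∷ g)  = (x + y) ∷ (f +ᴾ g)

  _-ᴾ_ : Poly → Poly → Poly
  f -ᴾ g = f +ᴾ map (-_) g

  _*ᴾ_ : Poly → Poly → Poly
  []       *ᴾ g = []
  (x ∷ f)  *ᴾ g = map (x *_) g +ᴾ (0# ∷ (f *ᴾ g))

  _^ᴾ_ : Poly → ℕ → Poly
  f ^ᴾ zero   = 1# ∷ []
  f ^ᴾ suc n  = f *ᴾ f ^ᴾ n

  _X^_ : Carrier → ℕ → Poly
  x X^ n = replicate n 0# ++ (x ∷ [])

  eval : Poly → Carrier → Carrier
  eval f x = foldr (λ b r → b + x * r) 0# f

  Permutes : Poly → Set (a ⊔ ℓ)
  Permutes f = Bijective _≈_ _≈_ (eval f)

-- A Heyting field with finitely many elements is the same as a finite field in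
-- the classical sense: `_≈_` is decidable, invertibility of an element is
-- decidable by search, and hence `x # y` holds exactly when `x ≈ y` fails.
-- Tightness of `_#_` also rules out the zero ring.
module FieldNotation {a ℓ₁ ℓ₂ : Level} (F : HeytingField a ℓ₁ ℓ₂) where

  commutativeRing : CommutativeRing a ℓ₁
  commutativeRing =
    HeytingCommutativeRing.commutativeRing (HeytingField.heytingCommutativeRing F)

  open CommutativeRing commutativeRing public
    using (Carrier; _≈_; _≉_; _+_; _*_; -_; 0#; 1#)
  open import Algebra.Properties.Semiring.Exp
    (CommutativeRing.semiring commutativeRing) public using (_^_)
  open Polynomials commutativeRing public

  HasOrder : ℕ → Set (a ⊔ ℓ₁)
  HasOrder n = Inverse (CommutativeRing.setoid commutativeRing) (setoid (Fin n))

  fPoly : (q Q : ℕ) → Carrier → Poly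
  fPoly q Q c =
    (1# X^ q -ᴾ 1# X^ 1) ^ᴾ 3
      +ᴾ (c ^ (q ℕ.^ 2)) X^ (q ℕ.^ 2 ℕ.* Q)
      +ᴾ (c ^ q) X^ (q ℕ.* Q)
      +ᴾ c X^ Q

-- Write σ x = x^q, D x = σ x - x, Tr for the trace to the fixed field K of σ, and
-- τ x = x^Q, so that f x = (D x)³ + Tr (c τ x).  For u in K, f (x + u) = f x + Tr c · τ u,
-- and τ permutes K.  Hence if f is injective then Tr c ≠ 0, and (given Tr c ≠ 0) f is
-- injective exactly when D x is determined by (D x)³ modulo K.
--
-- If 3 ∣ q, then every value of f has trace 0, so f is not surjective when Tr c ≠ 0.
-- If q ≡ 1 mod 3, then K contains ω ≠ 1 with ω³ = 1, and x, ω x have the same (D x)³.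
-- If q ≡ 2 mod 3, let y have trace 0; then D (y³) = D y · N y with the quadratic form
-- N y = y² + y σ y + (σ y)², which is anisotropic and takes values in K.  If
-- D y · N y = D z · N z, then y N y - z N z lies in K and has trace 0, so it vanishes;
-- applying N gives (N y)³ = (N z)³, whence N y = N z and y = z.

module Submission where

open import Defs
open import Algebra.Apartness.Bundles using (HeytingField)
open import Algebra.Bundles using (CommutativeRing)
open import Algebra.Solver.Ring.AlmostCommutativeRing using (fromCommutativeRing; _-Raw-AlmostCommutative⟶_)
open import Data.Empty using (⊥-elim)
open import Data.Fin.Base as Fin using (Fin; zero; suc; fromℕ; inject₁; punchIn; punchOut)
open import Data.Fin.Permutation as Perm using (Permutation′)
import Data.Fin.Properties as Fin
open import Data.Integer.Base as ℤ using (ℤ; -[1+_])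
import Data.Integer.Properties as ℤ
open import Data.List.Base using ([]; _∷_; map)
open import Data.Maybe.Base using (Maybe; just; nothing)
open import Data.Nat.Base as ℕ using (ℕ; zero; suc; _>_; _%_; _!; _∸_)
open import Data.Nat.Combinatorics using (_C_; nCk≡n!/k![n-k]!; k![n∸k]!∣n!; nCn≡1)
open import Data.Nat.DivMod using (m*[n/m]≡n; m≡m%n+[m/n]*n; m%n<n)
open import Data.Nat.Divisibility using (_∣_; _∤_; divides; ∣⇒≤; ∣m⇒∣m*n; ∣-refl; ∣1⇒≡1)
open import Data.Nat.Primality using (Prime; euclidsLemma; prime⇒nonZero; prime⇒nonTrivial; prime⇒irreducible; prime?)
import Data.Nat.Properties as ℕ
import Data.Nat.Tactic.RingSolver as ℕ
open import Data.Product.Base using (_×_; _,_; proj₁; ∃-syntax)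
open import Data.Sum.Base using (inj₁; inj₂)
open import Data.Vec.Base as Vec using (Vec; []; _∷_)
open import Function.Base using (_∘_)
open import Function.Bundles using (_⇔_; Inverse; mk⇔)
open import Function.Definitions using (Injective)
open import Level using (Level)
open import Relation.Binary.PropositionalEquality as ≡ using (_≡_)
open import Relation.Nullary using (¬_; Dec; yes; no; contradiction)
open import Relation.Nullary.Decidable using (map′; toWitness)

-- Solving ring identities with integer coefficients.

module IntegerCoefficients {a ℓ : Level} (R : CommutativeRing a ℓ) where
  open CommutativeRing R hiding (zero)
  open import Algebra.Properties.Semiring.Mult.TCOptimised semiring
    using (×1-homo-*; 1+×) renaming (_×_ to _·_; ×-homo-+ to ·-homo-+)
  open import Algebra.Properties.AbelianGroup +-abelianGroup using (⁻¹-∙-comm)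
  open import Algebra.Properties.Group +-group using (⁻¹-involutive; ε⁻¹≈ε)
  open import Algebra.Properties.Ring ring using (-‿distribˡ-*; -‿distribʳ-*)
  open import Relation.Binary.Reasoning.Setoid (CommutativeRing.setoid R)
  import Algebra.Solver.CommutativeMonoid +-commutativeMonoid as +-Solver

  private
    -- The optimised multiple makes `1 · 1#` reduce to `1#`, so the solver's constants 0 and 1 are
    -- definitionally `0#` and `1#`.
    fromℤ : ℤ → Carrier
    fromℤ (ℤ.+ n)  = n · 1#
    fromℤ -[1+ n ] = - (suc n · 1#)

    fromℤ-neg : ∀ i → fromℤ (ℤ.- i) ≈ - fromℤ i
    fromℤ-neg (ℤ.+ zero)  = sym ε⁻¹≈ε
    fromℤ-neg (ℤ.+ suc n) = refl
    fromℤ-neg -[1+ n ]    = sym (⁻¹-involutive _)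

    fromℤ-⊖ : ∀ m n → fromℤ (m ℤ.⊖ n) ≈ m · 1# - n · 1#
    fromℤ-⊖ m       zero    = sym (trans (+-congˡ ε⁻¹≈ε) (+-identityʳ _))
    fromℤ-⊖ zero    (suc n) = sym (+-identityˡ _)
    fromℤ-⊖ (suc m) (suc n) = begin
      fromℤ (suc m ℤ.⊖ suc n)               ≡⟨ ≡.cong fromℤ (ℤ.[1+m]⊖[1+n]≡m⊖n m n) ⟩
      fromℤ (m ℤ.⊖ n)                       ≈⟨ fromℤ-⊖ m n ⟩
      m · 1# - n · 1#                       ≈⟨ +-identityˡ _ ⟨
      0# + (m · 1# - n · 1#)                ≈⟨ +-congʳ (-‿inverseʳ 1#) ⟨
      (1# - 1#) + (m · 1# - n · 1#)         ≈⟨ +-Solver.solve 4 (λ x y z w →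
        ((x +-Solver.⊕ y) +-Solver.⊕ (z +-Solver.⊕ w)) +-Solver.⊜
        ((x +-Solver.⊕ z) +-Solver.⊕ (y +-Solver.⊕ w))) refl _ _ _ _ ⟩
      (1# + m · 1#) + (- 1# - n · 1#)       ≈⟨ +-congˡ (⁻¹-∙-comm 1# _) ⟩
      (1# + m · 1#) - (1# + n · 1#)         ≈⟨ +-cong (1+× m 1#) (-‿cong (1+× n 1#)) ⟨
      suc m · 1# - suc n · 1#               ∎

    fromℤ-+ : ∀ i j → fromℤ (i ℤ.+ j) ≈ fromℤ i + fromℤ j
    fromℤ-+ (ℤ.+ m)  (ℤ.+ n)  = ·-homo-+ 1# m n
    fromℤ-+ (ℤ.+ m)  -[1+ n ] = fromℤ-⊖ m (suc n)
    fromℤ-+ -[1+ m ] (ℤ.+ n)  = trans (fromℤ-⊖ n (suc m)) (+-comm _ _)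
    fromℤ-+ -[1+ m ] -[1+ n ] = begin
      - (suc (suc (m ℕ.+ n)) · 1#)         ≡⟨ ≡.cong (λ k → - (suc k · 1#)) (ℕ.+-suc m n) ⟨
      - ((suc m ℕ.+ suc n) · 1#)           ≈⟨ -‿cong (·-homo-+ 1# (suc m) (suc n)) ⟩
      - (suc m · 1# + suc n · 1#)          ≈⟨ ⁻¹-∙-comm _ _ ⟨
      - (suc m · 1#) - (suc n · 1#)        ∎

    fromℤ-pos-* : ∀ m j → fromℤ (ℤ.+ m ℤ.* j) ≈ m · 1# * fromℤ j
    fromℤ-pos-* m (ℤ.+ n) = begin
      fromℤ (ℤ.+ m ℤ.* ℤ.+ n) ≡⟨ ≡.cong fromℤ (ℤ.pos-* m n) ⟨
      (m ℕ.* n) · 1#          ≈⟨ ×1-homo-* m n ⟩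
      m · 1# * n · 1#         ∎
    fromℤ-pos-* m -[1+ n ] = begin
      fromℤ (ℤ.+ m ℤ.* -[1+ n ])              ≡⟨ ≡.cong fromℤ (ℤ.neg-distribʳ-* (ℤ.+ m) (ℤ.+ suc n)) ⟨
      fromℤ (ℤ.- (ℤ.+ m ℤ.* ℤ.+ suc n))       ≈⟨ fromℤ-neg (ℤ.+ m ℤ.* ℤ.+ suc n) ⟩
      - fromℤ (ℤ.+ m ℤ.* ℤ.+ suc n)           ≈⟨ -‿cong (fromℤ-pos-* m (ℤ.+ suc n)) ⟩
      - (m · 1# * suc n · 1#)                 ≈⟨ -‿distribʳ-* _ _ ⟩
      m · 1# * - (suc n · 1#)                 ∎

    fromℤ-* : ∀ i j → fromℤ (i ℤ.* j) ≈ fromℤ i * fromℤ j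
    fromℤ-* (ℤ.+ m)  j = fromℤ-pos-* m j
    fromℤ-* -[1+ m ] j = begin
      fromℤ (-[1+ m ] ℤ.* j)          ≡⟨ ≡.cong fromℤ (ℤ.neg-distribˡ-* (ℤ.+ suc m) j) ⟨
      fromℤ (ℤ.- (ℤ.+ suc m ℤ.* j))   ≈⟨ fromℤ-neg (ℤ.+ suc m ℤ.* j) ⟩
      - fromℤ (ℤ.+ suc m ℤ.* j)       ≈⟨ -‿cong (fromℤ-pos-* (suc m) j) ⟩
      - (suc m · 1# * fromℤ j)        ≈⟨ -‿distribˡ-* _ _ ⟩
      - (suc m · 1#) * fromℤ j        ∎

    ℤ→R : ℤ.+-*-rawRing -Raw-AlmostCommutative⟶ fromCommutativeRing R
    ℤ→R = record
      { ⟦_⟧ = fromℤ ; +-homo = fromℤ-+ ; *-homo = fromℤ-* ; -‿homo = fromℤ-neg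
      ; 0-homo = refl ; 1-homo = refl }

    -- Coefficients are compared as integers, not in `R`, so the solver proves only identities valid
    -- in every commutative ring.
    dec : ∀ i j → Maybe (fromℤ i ≈ fromℤ j)
    dec i j with i ℤ.≟ j
    ... | yes ≡.refl = just refl
    ... | no _       = nothing

  open import Algebra.Solver.Ring ℤ.+-*-rawRing (fromCommutativeRing R) ℤ→R dec public
    using (solve; con; _:=_; _:+_; _:*_; _:-_; :-_; _:^_)

-- Compatibility of evaluation with the polynomial operations.

module Evaluation {a ℓ : Level} (R : CommutativeRing a ℓ) where
  open CommutativeRing R hiding (zero)
  open Polynomials R
  open IntegerCoefficients R
  open import Algebra.Properties.Semiring.Exp semiring
  open import Relation.Binary.Reasoning.Setoid (CommutativeRing.setoid R)

  eval-+ᴾ : ∀ f g x → eval (f +ᴾ g) x ≈ eval f x + eval g x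
  eval-+ᴾ []      g       x = sym (+-identityˡ _)
  eval-+ᴾ (b ∷ f) []      x = sym (+-identityʳ _)
  eval-+ᴾ (b ∷ f) (d ∷ g) x = begin
    b + d + x * eval (f +ᴾ g) x              ≈⟨ +-congˡ (*-congˡ (eval-+ᴾ f g x)) ⟩
    b + d + x * (eval f x + eval g x)        ≈⟨ solve 5 (λ b d x s t →
      b :+ d :+ x :* (s :+ t) := (b :+ x :* s) :+ (d :+ x :* t)) refl _ _ _ _ _ ⟩
    (b + x * eval f x) + (d + x * eval g x)  ∎

  eval-map-* : ∀ b f x → eval (map (b *_) f) x ≈ b * eval f x
  eval-map-* b []      x = sym (zeroʳ b)
  eval-map-* b (d ∷ f) x = trans (+-congˡ (*-congˡ (eval-map-* b f x)))
    (solve 4 (λ b d x s → b :* d :+ x :* (b :* s) := b :* (d :+ x :* s)) refl _ _ _ _)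

  eval-map-neg : ∀ f x → eval (map (-_) f) x ≈ - eval f x
  eval-map-neg []      x = solve 0 (con (ℤ.+ 0) := :- con (ℤ.+ 0)) refl
  eval-map-neg (d ∷ f) x = trans (+-congˡ (*-congˡ (eval-map-neg f x)))
    (solve 3 (λ d x s → :- d :+ x :* (:- s) := :- (d :+ x :* s)) refl _ _ _)

  eval--ᴾ : ∀ f g x → eval (f -ᴾ g) x ≈ eval f x - eval g x
  eval--ᴾ f g x = trans (eval-+ᴾ f (map (-_) g) x) (+-congˡ (eval-map-neg g x))

  eval-*ᴾ : ∀ f g x → eval (f *ᴾ g) x ≈ eval f x * eval g x
  eval-*ᴾ []      g x = sym (zeroˡ _)
  eval-*ᴾ (b ∷ f) g x = begin
    eval (map (b *_) g +ᴾ (0# ∷ f *ᴾ g)) x            ≈⟨ eval-+ᴾ (map (b *_) g) _ x ⟩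
    eval (map (b *_) g) x + (0# + x * eval (f *ᴾ g) x) ≈⟨ +-cong (eval-map-* b g x) (+-congˡ (*-congˡ (eval-*ᴾ f g x))) ⟩
    b * eval g x + (0# + x * (eval f x * eval g x))   ≈⟨ solve 4 (λ b x s t →
      b :* t :+ (con (ℤ.+ 0) :+ x :* (s :* t)) := (b :+ x :* s) :* t) refl _ _ _ _ ⟩
    (b + x * eval f x) * eval g x                     ∎

  eval-^ᴾ : ∀ f n x → eval (f ^ᴾ n) x ≈ eval f x ^ n
  eval-^ᴾ f zero    x = trans (+-congˡ (zeroʳ x)) (+-identityʳ 1#)
  eval-^ᴾ f (suc n) x = trans (eval-*ᴾ f (f ^ᴾ n) x) (*-congˡ (eval-^ᴾ f n x))

  eval-X^ : ∀ b n x → eval (b X^ n) x ≈ b * x ^ n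
  eval-X^ b zero    x = trans (+-congˡ (zeroʳ x)) (trans (+-identityʳ b) (sym (*-identityʳ b)))
  eval-X^ b (suc n) x = trans (+-congˡ (*-congˡ (eval-X^ b n x)))
    (solve 3 (λ b x s → con (ℤ.+ 0) :+ x :* (b :* s) := b :* (x :* s)) refl _ _ _)

-- Arithmetic of natural numbers: primes, factorials and binomial coefficients.

[1+3j]³≡ : ∀ j → (1 ℕ.+ j ℕ.* 3) ℕ.* ((1 ℕ.+ j ℕ.* 3) ℕ.* ((1 ℕ.+ j ℕ.* 3) ℕ.* 1)) ≡
           1 ℕ.+ j ℕ.* (3 ℕ.+ 9 ℕ.* j ℕ.+ 9 ℕ.* (j ℕ.* j)) ℕ.* 3
[1+3j]³≡ = ℕ.solve-∀

-- By Euclid's lemma p would divide one of the factors 1, ..., k, all of which are smaller than p.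
prime∤k! : ∀ {p} → Prime p → ∀ {k} → k ℕ.< p → p ∤ k !
prime∤k! {p} pr {zero}  _ p∣1 = contradiction (∣1⇒≡1 p∣1) (ℕ.nonTrivial⇒≢1 {{prime⇒nonTrivial pr}})
prime∤k! {p} pr {suc k} k<p p∣k! with euclidsLemma (suc k) (k !) pr p∣k!
... | inj₁ p∣1+k = ℕ.<⇒≱ k<p (∣⇒≤ p∣1+k)
... | inj₂ p∣k!′ = prime∤k! pr (ℕ.<-trans (ℕ.n<1+n k) k<p) p∣k!′

-- Serves to turn divisibility of q by 3 into p = 3.
prime∣prime^⇒≡ : ∀ {p r} → Prime p → Prime r → ∀ m → r ∣ p ℕ.^ m → r ≡ p
prime∣prime^⇒≡ _ r-prime zero    r∣1 = contradiction (∣1⇒≡1 r∣1) (ℕ.nonTrivial⇒≢1 {{prime⇒nonTrivial r-prime}})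
prime∣prime^⇒≡ p-prime r-prime (suc m) r∣p^m with euclidsLemma _ (_ ℕ.^ m) r-prime r∣p^m
... | inj₂ r∣p^m′ = prime∣prime^⇒≡ p-prime r-prime m r∣p^m′
... | inj₁ r∣p with prime⇒irreducible p-prime r∣p
... | inj₁ r≡1 = contradiction r≡1 (ℕ.nonTrivial⇒≢1 {{prime⇒nonTrivial r-prime}})
... | inj₂ r≡p = r≡p

-- The prime p divides p!, which is k! (p - k)! times the binomial coefficient, but it divides
-- neither factorial.
prime∣binomial : ∀ {p} → Prime p → ∀ {k} → 0 ℕ.< k → k ℕ.< p → p ∣ p C k
prime∣binomial {p} pr {k} 0<k k<p with euclidsLemma (k ! ℕ.* (p ∸ k) !) (p C k) pr p∣[k![p-k]!]*C
  where
  instance k![p-k]!≢0 = k ℕ.!* (p ∸ k) !≢0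
  k![p-k]!*C≡p! : (k ! ℕ.* (p ∸ k) !) ℕ.* (p C k) ≡ p !
  k![p-k]!*C≡p! = ≡.trans
    (≡.cong (k ! ℕ.* (p ∸ k) ! ℕ.*_) (nCk≡n!/k![n-k]! (ℕ.<⇒≤ k<p)))
    (m*[n/m]≡n (k![n∸k]!∣n! (ℕ.<⇒≤ k<p)))
  n∣n! : ∀ n → .{{ℕ.NonZero n}} → n ∣ n !
  n∣n! (suc n) = ∣m⇒∣m*n (n !) ∣-refl
  p∣[k![p-k]!]*C : p ∣ (k ! ℕ.* (p ∸ k) !) ℕ.* (p C k)
  p∣[k![p-k]!]*C = ≡.subst (p ∣_) (≡.sym k![p-k]!*C≡p!) (n∣n! p {{prime⇒nonZero pr}})
... | inj₂ p∣C = p∣C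
... | inj₁ p∣k![p-k]! with euclidsLemma (k !) ((p ∸ k) !) pr p∣k![p-k]!
... | inj₁ p∣k!     = contradiction p∣k! (prime∤k! pr k<p)
... | inj₂ p∣[p-k]! = contradiction p∣[p-k]! (prime∤k! pr (ℕ.∸-monoʳ-< 0<k (ℕ.<⇒≤ k<p)))

-- Additivity of p-power maps in characteristic p.

module _ {a ℓ : Level} (R : CommutativeRing a ℓ) where
  open CommutativeRing R hiding (zero)
  open import Algebra.Properties.CommutativeSemiring.Exp commutativeSemiring
  open import Algebra.Properties.CommutativeSemiring.Binomial commutativeSemiring
    using (binomialTerm) renaming (theorem to binomial-theorem)
  open import Algebra.Properties.CommutativeMonoid.Sum +-commutativeMonoid
    using (sum; sum-cong-≋; sum-replicate-zero; sum-init-last)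
  open import Algebra.Properties.Semiring.Mult semiring
    using (×-congʳ; ×-assocˡ; ×-assoc-*) renaming (_×_ to _·_)
  open import Relation.Binary.Reasoning.Setoid (CommutativeRing.setoid R)

  ∣⇒·≈0 : ∀ {p n} → p · 1# ≈ 0# → p ∣ n → ∀ x → n · x ≈ 0#
  ∣⇒·≈0 {p} {n} p·1≈0 (divides j ≡.refl) x = begin
    (j ℕ.* p) · x         ≡⟨ ≡.cong (_· x) (ℕ.*-comm j p) ⟩
    (p ℕ.* j) · x         ≈⟨ ×-assocˡ x p j ⟨
    p · (j · x)           ≈⟨ ×-congʳ p (*-identityˡ _) ⟨
    p · (1# * j · x)      ≈⟨ ×-assoc-* p 1# _ ⟨
    p · 1# * j · x        ≈⟨ *-congʳ p·1≈0 ⟩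
    0# * j · x            ≈⟨ zeroˡ _ ⟩
    0#                    ∎

  -- In the binomial expansion every coefficient strictly between the two ends is a multiple of p,
  -- so only the end terms survive.
  ^p-distrib-+ : ∀ {p} → Prime p → p · 1# ≈ 0# → ∀ x y → (x + y) ^ p ≈ x ^ p + y ^ p
  ^p-distrib-+ {zero}      pr with () ← prime⇒nonZero pr
  ^p-distrib-+ {p@(suc m)} pr p·1≈0 x y = begin
    (x + y) ^ p                                  ≈⟨ binomial-theorem p x y ⟩
    t zero + sum (t ∘ suc)                       ≈⟨ +-congˡ (sum-init-last (t ∘ suc)) ⟩
    t zero + (sum (λ i → t (suc (inject₁ i))) + t (suc (fromℕ m)))
      ≈⟨ +-congˡ (+-congʳ (trans (sum-cong-≋ middle≈0) (sum-replicate-zero m))) ⟩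
    t zero + (0# + t (suc (fromℕ m)))            ≈⟨ +-cong first≈ (trans (+-identityˡ _) last≈) ⟩
    y ^ p + x ^ p                                ≈⟨ +-comm _ _ ⟩
    x ^ p + y ^ p                                ∎
    where
    t : Fin (suc p) → Carrier
    t = binomialTerm x y p
    first≈ : t zero ≈ y ^ p
    first≈ = trans (+-identityʳ _) (*-identityˡ _)
    last≈ : t (suc (fromℕ m)) ≈ x ^ p
    last≈ = begin
      t (suc (fromℕ m))               ≡⟨ ≡.cong (λ k → (p C suc k) · (x ^ suc k * y ^ (m ∸ k))) (Fin.toℕ-fromℕ m) ⟩
      (p C p) · (x ^ p * y ^ (m ∸ m)) ≡⟨ ≡.cong₂ (λ i j → i · (x ^ p * y ^ j)) (nCn≡1 p) (ℕ.n∸n≡0 m) ⟩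
      x ^ p * 1# + 0#                 ≈⟨ trans (+-identityʳ _) (*-identityʳ _) ⟩
      x ^ p                           ∎
    middle≈0 : ∀ i → t (suc (inject₁ i)) ≈ 0#
    middle≈0 i = ∣⇒·≈0 p·1≈0 (prime∣binomial pr ℕ.z<s
      (ℕ.s<s (≡.subst (ℕ._< m) (≡.sym (Fin.toℕ-inject₁ i)) (Fin.toℕ<n i)))) _

  ^p^m-distrib-+ : ∀ {p} → Prime p → p · 1# ≈ 0# →
                   ∀ m x y → (x + y) ^ (p ℕ.^ m) ≈ x ^ (p ℕ.^ m) + y ^ (p ℕ.^ m)
  ^p^m-distrib-+ {p} pr p·1≈0 zero    x y =
    trans (*-identityʳ _) (sym (+-cong (*-identityʳ x) (*-identityʳ y)))
  ^p^m-distrib-+ {p} pr p·1≈0 (suc m) x y = begin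
    (x + y) ^ (p ℕ.* p ℕ.^ m)                      ≈⟨ ^-assocʳ (x + y) p (p ℕ.^ m) ⟨
    ((x + y) ^ p) ^ (p ℕ.^ m)                      ≈⟨ ^-congˡ (p ℕ.^ m) (^p-distrib-+ pr p·1≈0 x y) ⟩
    (x ^ p + y ^ p) ^ (p ℕ.^ m)                    ≈⟨ ^p^m-distrib-+ pr p·1≈0 m _ _ ⟩
    (x ^ p) ^ (p ℕ.^ m) + (y ^ p) ^ (p ℕ.^ m)      ≈⟨ +-cong (^-assocʳ x p _) (^-assocʳ y p _) ⟩
    x ^ (p ℕ.* p ℕ.^ m) + y ^ (p ℕ.* p ℕ.^ m)      ∎

-- Finite fields with n nonzero elements: inverses and the pigeonhole principle.

module FiniteField {a ℓ₁ ℓ₂ : Level} (F : HeytingField a ℓ₁ ℓ₂)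
                   (n : ℕ) (order : FieldNotation.HasOrder F (suc n)) where
  open FieldNotation F using (commutativeRing) public
  open CommutativeRing commutativeRing hiding (zero)
  open IntegerCoefficients commutativeRing
  open import Algebra.Properties.CommutativeSemiring.Exp commutativeSemiring
  open import Algebra.Properties.Semiring.Mult semiring using () renaming (_×_ to _·_)
  open import Algebra.Properties.Group +-group using (∙-cancelʳ; x∙y⁻¹≈ε⇒x≈y)
  import Algebra.Properties.CommutativeMonoid.Sum +-commutativeMonoid as Sum
  import Algebra.Properties.CommutativeMonoid.Sum *-commutativeMonoid as Product
  open import Relation.Binary.Reasoning.Setoid (CommutativeRing.setoid commutativeRing)

  private
    elem : Fin (suc n) → Carrier
    elem = Inverse.from order

    index : Carrier → Fin (suc n)
    index = Inverse.to order

    elem-index : ∀ x → elem (index x) ≈ x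
    elem-index x = Inverse.inverseʳ order ≡.refl

    index-elem : ∀ i → index (elem i) ≡ i
    index-elem i = Inverse.inverseˡ order refl

    index-injective : ∀ {x y} → index x ≡ index y → x ≈ y
    index-injective {x} {y} eq = begin
      x              ≈⟨ elem-index x ⟨
      elem (index x) ≡⟨ ≡.cong elem eq ⟩
      elem (index y) ≈⟨ elem-index y ⟩
      y              ∎

    elem-injective : ∀ {i j} → elem i ≈ elem j → i ≡ j
    elem-injective {i} {j} eq =
      ≡.trans (≡.sym (index-elem i)) (≡.trans (Inverse.to-cong order eq) (index-elem j))

  infix 4 _≟_
  _≟_ : ∀ x y → Dec (x ≈ y)
  x ≟ y = map′ index-injective (Inverse.to-cong order) (index x Fin.≟ index y)

  1≉0 : 1# ≉ 0#
  1≉0 1≈0 = HeytingField.#-irrefl F 1≈0 1#0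
    where open import Algebra.Apartness.Properties.HeytingCommutativeRing
                 (HeytingField.heytingCommutativeRing F) using (1#0)

  -- The inverse is found by search. If the search fails, x cannot be apart from 0, since apartness
  -- yields an inverse, and tightness then gives x = 0.
  inverse : ∀ x → x ≉ 0# → ∃[ y ] x * y ≈ 1#
  inverse x x≉0 with Fin.any? (λ i → x * elem i ≟ 1#)
  ... | yes (i , eq)  = elem i , eq
  ... | no noInverse = contradiction (proj₁ (HeytingField.tight F x 0#) ¬x#0) x≉0
    where
    ¬x#0 : ¬ HeytingField._#_ F x 0#
    ¬x#0 x#0 with (y , _ , [x-0]y≈1) ← HeytingField.#⇒invertible F x#0 = noInverse (index y , (begin
      x * elem (index y) ≈⟨ *-congˡ (elem-index y) ⟩
      x * y              ≈⟨ solve 2 (λ x y → x :* y := (x :- con (ℤ.+ 0)) :* y) refl x y ⟩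
      (x - 0#) * y       ≈⟨ [x-0]y≈1 ⟩
      1#                 ∎))

  *-cancelˡ : ∀ x {y z} → x ≉ 0# → x * y ≈ x * z → y ≈ z
  *-cancelˡ x {y} {z} x≉0 xy≈xz with (x⁻¹ , xx⁻¹≈1) ← inverse x x≉0 = begin
    y              ≈⟨ [xx⁻¹]w≈w y ⟨
    x⁻¹ * (x * y)  ≈⟨ *-congˡ xy≈xz ⟩
    x⁻¹ * (x * z)  ≈⟨ [xx⁻¹]w≈w z ⟩
    z              ∎
    where
    [xx⁻¹]w≈w : ∀ w → x⁻¹ * (x * w) ≈ w
    [xx⁻¹]w≈w w = begin
      x⁻¹ * (x * w)  ≈⟨ solve 3 (λ x x⁻¹ w → x⁻¹ :* (x :* w) := (x :* x⁻¹) :* w) refl x x⁻¹ w ⟩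
      (x * x⁻¹) * w  ≈⟨ *-congʳ xx⁻¹≈1 ⟩
      1# * w         ≈⟨ *-identityˡ w ⟩
      w              ∎

  xy≈0⇒y≈0 : ∀ {x y} → x ≉ 0# → x * y ≈ 0# → y ≈ 0#
  xy≈0⇒y≈0 {x} x≉0 xy≈0 = *-cancelˡ x x≉0 (trans xy≈0 (sym (zeroʳ x)))

  x^m≈0⇒x≈0 : ∀ {x} m → x ^ m ≈ 0# → x ≈ 0#
  x^m≈0⇒x≈0     zero    1≈0 = contradiction 1≈0 1≉0
  x^m≈0⇒x≈0 {x} (suc m) eq with x ≟ 0#
  ... | yes x≈0 = x≈0
  ... | no  x≉0 = contradiction (x^m≈0⇒x≈0 m (xy≈0⇒y≈0 x≉0 eq)) x≉0

  -- If y were missed, deleting its index from the codomain would give an injection from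
  -- `Fin (suc n)` into `Fin n`.
  injective⇒surjective : (f : Carrier → Carrier) → (∀ {x y} → x ≈ y → f x ≈ f y) →
                         Injective _≈_ _≈_ f → ∀ y → ∃[ x ] f x ≈ y
  injective⇒surjective f f-cong f-inj y with Fin.any? (λ i → f (elem i) ≟ y)
  ... | yes (i , eq) = elem i , eq
  ... | no  notHit   = ⊥-elim (Fin.<⇒notInjective (ℕ.n<1+n n) g-injective)
    where
    y≢f : ∀ i → index y ≡.≢ index (f (elem i))
    y≢f i eq = notHit (i , sym (index-injective eq))
    g : Fin (suc n) → Fin n
    g i = punchOut (y≢f i)
    g-injective : Injective _≡_ _≡_ g
    g-injective {i} {j} eq = elem-injective (f-inj (index-injective (Fin.punchOut-injective (y≢f i) (y≢f j) eq)))

  -- The order annihilates 1, and Fermat's little theorem.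

  private
    permutation : (f g : Carrier → Carrier) → (∀ {x y} → x ≈ y → f x ≈ f y) → (∀ {x y} → x ≈ y → g x ≈ g y) →
                  (∀ x → f (g x) ≈ x) → (∀ x → g (f x) ≈ x) → Permutation′ (suc n)
    permutation f g f-cong g-cong fg≈id gf≈id = Perm.permutation (conj f) (conj g)
      (inverts f g f-cong fg≈id) (inverts g f g-cong gf≈id)
      where
      conj : (Carrier → Carrier) → Fin (suc n) → Fin (suc n)
      conj h i = index (h (elem i))
      inverts : ∀ h k → (∀ {x y} → x ≈ y → h x ≈ h y) → (∀ x → h (k x) ≈ x) → ∀ i → conj h (conj k i) ≡ i
      inverts h k h-cong hk≈id i = ≡.trans
        (Inverse.to-cong order (trans (h-cong (elem-index _)) (hk≈id (elem i)))) (index-elem i)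

  -- Translation by 1 permutes the elements, so it leaves their sum unchanged.
  order·1≈0 : suc n · 1# ≈ 0#
  order·1≈0 = ∙-cancelʳ total (suc n · 1#) 0# (begin
    suc n · 1# + total                              ≈⟨ +-congʳ (Sum.sum-replicate (suc n)) ⟨
    Sum.sum {suc n} (λ _ → 1#) + total              ≈⟨ Sum.∑-distrib-+ {suc n} (λ _ → 1#) elem ⟨
    Sum.sum (λ i → 1# + elem i)                     ≈⟨ Sum.sum-cong-≋ (λ i → elem-index (1# + elem i)) ⟨
    Sum.sum (λ i → elem (translate Perm.⟨$⟩ʳ i))    ≈⟨ Sum.sum-permute elem translate ⟨
    total                                           ≈⟨ +-identityˡ total ⟨
    0# + total                                      ∎)
    where
    total : Carrier
    total = Sum.sum elem
    translate : Permutation′ (suc n)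
    translate = permutation (1# +_) (- 1# +_) +-congˡ +-congˡ
      (λ x → solve 1 (λ x → con (ℤ.+ 1) :+ (:- con (ℤ.+ 1) :+ x) := x) refl x)
      (λ x → solve 1 (λ x → :- con (ℤ.+ 1) :+ (con (ℤ.+ 1) :+ x) := x) refl x)

  -- Multiplication by x permutes the n nonzero elements, so their nonzero product equals itself
  -- times x^n.
  x≉0⇒x^n≈1 : ∀ x → x ≉ 0# → x ^ n ≈ 1#
  x≉0⇒x^n≈1 x x≉0 with (x⁻¹ , xx⁻¹≈1) ← inverse x x≉0 = *-cancelˡ total total≉0 (begin
    total * x ^ n                                       ≈⟨ *-comm _ _ ⟩
    x ^ n * total                                       ≈⟨ *-congʳ Πscale≈x^n ⟨
    Product.sum (scale ∘ elem) * total                  ≈⟨ Product.∑-distrib-+ (scale ∘ elem) (unit ∘ elem) ⟨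
    Product.sum (λ i → scale (elem i) * unit (elem i))  ≈⟨ Product.sum-cong-≋ (λ i → scale*unit (elem i)) ⟩
    Product.sum (λ i → unit (x * elem i))               ≈⟨ Product.sum-cong-≋ (λ i → unit-cong (elem-index (x * elem i))) ⟨
    Product.sum (λ i → unit (elem (dilate Perm.⟨$⟩ʳ i))) ≈⟨ Product.sum-permute (unit ∘ elem) dilate ⟨
    total                                               ≈⟨ *-identityʳ total ⟨
    total * 1#                                          ∎)
    where
    -- Replacing 0 by 1 turns the product of all elements into that of the nonzero ones.
    unit scale : Carrier → Carrier
    unit y with y ≟ 0#
    ... | yes _ = 1#
    ... | no _  = y
    scale y with y ≟ 0#
    ... | yes _ = 1#
    ... | no _  = x

    unit-cong : ∀ {y z} → y ≈ z → unit y ≈ unit z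
    unit-cong {y} {z} y≈z with y ≟ 0# | z ≟ 0#
    ... | yes _   | yes _   = refl
    ... | no _    | no _    = y≈z
    ... | yes y≈0 | no z≉0  = contradiction (trans (sym y≈z) y≈0) z≉0
    ... | no y≉0  | yes z≈0 = contradiction (trans y≈z z≈0) y≉0

    unit≉0 : ∀ y → unit y ≉ 0#
    unit≉0 y with y ≟ 0#
    ... | yes _  = 1≉0
    ... | no y≉0 = y≉0

    scale*unit : ∀ y → scale y * unit y ≈ unit (x * y)
    scale*unit y with y ≟ 0# | x * y ≟ 0#
    ... | yes _   | yes _    = *-identityˡ 1#
    ... | no _    | no _     = refl
    ... | yes y≈0 | no xy≉0  = contradiction (trans (*-congˡ y≈0) (zeroʳ x)) xy≉0
    ... | no y≉0  | yes xy≈0 = contradiction (xy≈0⇒y≈0 x≉0 xy≈0) y≉0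

    total : Carrier
    total = Product.sum (unit ∘ elem)

    product≉0 : ∀ {m} (t : Fin m → Carrier) → (∀ i → t i ≉ 0#) → Product.sum t ≉ 0#
    product≉0 {zero}  t t≉0 = 1≉0
    product≉0 {suc m} t t≉0 eq = product≉0 (t ∘ suc) (t≉0 ∘ suc) (xy≈0⇒y≈0 (t≉0 zero) eq)

    total≉0 : total ≉ 0#
    total≉0 = product≉0 (unit ∘ elem) (unit≉0 ∘ elem)

    dilate : Permutation′ (suc n)
    dilate = permutation (x *_) (x⁻¹ *_) *-congˡ *-congˡ
      (λ y → trans (sym (*-assoc _ _ y)) (trans (*-congʳ xx⁻¹≈1) (*-identityˡ y)))
      (λ y → trans (sym (*-assoc _ _ y)) (trans (*-congʳ (trans (*-comm _ _) xx⁻¹≈1)) (*-identityˡ y)))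

    i₀ : Fin (suc n)
    i₀ = index 0#

    scale-0 : scale (elem i₀) ≈ 1#
    scale-0 with elem i₀ ≟ 0#
    ... | yes _  = refl
    ... | no neq = contradiction (elem-index 0#) neq

    scale-≉0 : ∀ i → scale (elem (punchIn i₀ i)) ≈ x
    scale-≉0 i with elem (punchIn i₀ i) ≟ 0#
    ... | no _   = refl
    ... | yes eq = contradiction (elem-injective (trans eq (sym (elem-index 0#)))) (Fin.punchInᵢ≢i i₀ i)

    Πscale≈x^n : Product.sum (scale ∘ elem) ≈ x ^ n
    Πscale≈x^n = begin
      Product.sum (scale ∘ elem)                                            ≈⟨ Product.sum-remove {i = i₀} (scale ∘ elem) ⟩
      scale (elem i₀) * Product.sum (λ i → scale (elem (punchIn i₀ i)))     ≈⟨ *-cong scale-0 (Product.sum-cong-≋ scale-≉0) ⟩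
      1# * Product.sum {n} (λ _ → x)                                        ≈⟨ *-identityˡ _ ⟩
      Product.sum {n} (λ _ → x)                                             ≈⟨ Product.sum-replicate n ⟩
      x ^ n                                                                 ∎

  x^order≈x : ∀ x → x ^ suc n ≈ x
  x^order≈x x with x ≟ 0#
  ... | yes x≈0 = trans (*-congʳ x≈0) (trans (zeroˡ _) (sym x≈0))
  ... | no x≉0  = trans (*-congˡ (x≉0⇒x^n≈1 x x≉0)) (*-identityʳ x)

  -- Roots of monic polynomials.

  -- The vector h stands for the monic polynomial with lower coefficients h.
  evalMonic : ∀ {m} → Vec Carrier m → Carrier → Carrier
  evalMonic []      x = 1#
  evalMonic (b ∷ h) x = b + x * evalMonic h x

  -- Synthetic division by X - r: the coefficients are the intermediate Horner values at r, and the
  -- result is again monic.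
  quotient : ∀ {m} → Vec Carrier (suc m) → Carrier → Vec Carrier m
  quotient (b ∷ [])        r = []
  quotient (b ∷ h@(_ ∷ _)) r = evalMonic h r ∷ quotient h r

  evalMonic-quotient : ∀ {m} (h : Vec Carrier (suc m)) r x →
    evalMonic h x - evalMonic h r ≈ (x - r) * evalMonic (quotient h r) x
  evalMonic-quotient (b ∷ [])        r x =
    solve 3 (λ b r x → (b :+ x :* con (ℤ.+ 1)) :- (b :+ r :* con (ℤ.+ 1)) := (x :- r) :* con (ℤ.+ 1)) refl b r x
  evalMonic-quotient (b ∷ h@(_ ∷ _)) r x = begin
    (b + x * hx) - (b + r * hr)         ≈⟨ solve 5 (λ b x r s t →
      (b :+ x :* s) :- (b :+ r :* t) := (x :- r) :* t :+ x :* (s :- t)) refl b x r hx hr ⟩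
    (x - r) * hr + x * (hx - hr)        ≈⟨ +-congˡ (*-congˡ (evalMonic-quotient h r x)) ⟩
    (x - r) * hr + x * ((x - r) * hq)   ≈⟨ solve 4 (λ x d s t →
      d :* s :+ x :* (d :* t) := d :* (s :+ x :* t)) refl x (x - r) hr hq ⟩
    (x - r) * (hr + x * hq)             ∎
    where
    hx hr hq : Carrier
    hx = evalMonic h x
    hr = evalMonic h r
    hq = evalMonic (quotient h r) x

  -- Dividing out the first root lowers the degree by one, and the other roots, being distinct from
  -- it, are roots of the quotient. In degree 0 the polynomial is 1.
  monic-roots : ∀ {m} (h : Vec Carrier m) (r : Fin (suc m) → Carrier) →
                Injective _≡_ _≈_ r → ¬ (∀ i → evalMonic h (r i) ≈ 0#)
  monic-roots {zero}  []      r r-inj root = 1≉0 (root zero)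
  monic-roots {suc m} h       r r-inj root =
    monic-roots (quotient h (r zero)) (r ∘ suc) (Fin.suc-injective ∘ r-inj) λ i →
      xy≈0⇒y≈0 (λ eq → Fin.0≢1+n (≡.sym (r-inj (x∙y⁻¹≈ε⇒x≈y _ _ eq)))) (begin
        (r (suc i) - r zero) * evalMonic (quotient h (r zero)) (r (suc i)) ≈⟨ evalMonic-quotient h (r zero) (r (suc i)) ⟨
        evalMonic h (r (suc i)) - evalMonic h (r zero)                     ≈⟨ +-cong (root (suc i)) (-‿cong (root zero)) ⟩
        0# - 0#                                                            ≈⟨ -‿inverseʳ 0# ⟩
        0#                                                                 ∎)

  evalMonic-replicate-0 : ∀ m x → evalMonic (Vec.replicate m 0#) x ≈ x ^ m
  evalMonic-replicate-0 zero    x = refl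
  evalMonic-replicate-0 (suc m) x = trans (+-identityˡ _) (*-congˡ (evalMonic-replicate-0 m x))

  -- The polynomial X^m - 1 has at most m roots, too few to vanish at all n nonzero elements; a
  -- search then finds a non-root.
  ∃x^m≉1 : ∀ m → 0 ℕ.< m → m ℕ.< n → ∃[ x ] x ≉ 0# × x ^ m ≉ 1#
  ∃x^m≉1 (suc m) _ m<n
    with Fin.all? (λ i → unit i ^ suc m ≟ 1#)
    where
    unit : Fin n → Carrier
    unit i = elem (punchIn (index 0#) i)
  ... | yes all≈1 = contradiction roots (monic-roots (- 1# ∷ Vec.replicate m 0#) r r-injective)
    where
    -- The exponent `suc m` is strictly below n, which leaves room for `suc (suc m)` distinct
    -- nonzero elements, one more than the degree.
    r : Fin (suc (suc m)) → Carrier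
    r i = elem (punchIn (index 0#) (Fin.inject≤ i m<n))
    r-injective : Injective _≡_ _≈_ r
    r-injective eq = Fin.inject≤-injective m<n m<n _ _ (Fin.punchIn-injective (index 0#) _ _ (elem-injective eq))
    roots : ∀ i → evalMonic (- 1# ∷ Vec.replicate m 0#) (r i) ≈ 0#
    roots i = begin
      - 1# + r i * evalMonic (Vec.replicate m 0#) (r i) ≈⟨ +-congˡ (*-congˡ (evalMonic-replicate-0 m (r i))) ⟩
      - 1# + r i ^ suc m                                ≈⟨ +-congˡ (all≈1 (Fin.inject≤ i m<n)) ⟩
      - 1# + 1#                                         ≈⟨ -‿inverseˡ 1# ⟩
      0#                                                ∎
  ... | no ¬all with (i , neq) ← Fin.¬∀⟶∃¬ n _ (λ i → _ ≟ _) ¬all =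
    _ , (λ eq → Fin.punchInᵢ≢i (index 0#) i (elem-injective (trans eq (sym (elem-index 0#))))) , neq

-- Frobenius maps of the field of order q³.

module PrimePowerField {a ℓ₁ ℓ₂ : Level} (F : HeytingField a ℓ₁ ℓ₂)
                       (n : ℕ) (order : FieldNotation.HasOrder F (suc n))
                       (p k ℓ : ℕ) (p-prime : Prime p)
                       (order≡q³ : suc n ≡ (p ℕ.^ k) ℕ.^ 3) where
  open FiniteField F n order
  open FieldNotation F using (fPoly; eval; _X^_; _+ᴾ_; _-ᴾ_; _^ᴾ_)
  open CommutativeRing commutativeRing hiding (zero)
  open IntegerCoefficients commutativeRing
  open Evaluation commutativeRing
  open import Algebra.Properties.CommutativeSemiring.Exp commutativeSemiring
  open import Algebra.Properties.Semiring.Mult semiring using (×1-homo-*) renaming (_×_ to _·_)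
  open import Algebra.Properties.Group +-group using (x∙y⁻¹≈ε⇒x≈y; x≈y⇒x∙y⁻¹≈ε; inverseʳ-unique)
  open import Algebra.Properties.Ring ring using (x+x≈x⇒x≈0)
  open import Relation.Binary.Reasoning.Setoid (CommutativeRing.setoid commutativeRing)

  q Q : ℕ
  q = p ℕ.^ k
  Q = p ℕ.^ ℓ

  three : Carrier
  three = 1# + 1# + 1#

  ^-·1 : ∀ m j → (m ℕ.^ j) · 1# ≈ (m · 1#) ^ j
  ^-·1 m zero    = +-identityʳ 1#
  ^-·1 m (suc j) = trans (×1-homo-* m (m ℕ.^ j)) (*-congˡ (^-·1 m j))

  q·1≈0 : q · 1# ≈ 0#
  q·1≈0 = x^m≈0⇒x≈0 3 (begin
    (q · 1#) ^ 3      ≈⟨ ^-·1 q 3 ⟨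
    (q ℕ.^ 3) · 1#    ≡⟨ ≡.cong (_· 1#) order≡q³ ⟨
    suc n · 1#        ≈⟨ order·1≈0 ⟩
    0#                ∎)

  -- The order q³ is a power of p and annihilates 1, so a power of `p · 1#` is 0, and a field has no
  -- nonzero nilpotents.
  p·1≈0 : p · 1# ≈ 0#
  p·1≈0 = x^m≈0⇒x≈0 k (trans (sym (^-·1 p k)) q·1≈0)

  1^m≈1 : ∀ m → 1# ^ m ≈ 1#
  1^m≈1 zero    = refl
  1^m≈1 (suc m) = trans (*-identityˡ _) (1^m≈1 m)

  ^-comm : ∀ x i j → (x ^ i) ^ j ≈ (x ^ j) ^ i
  ^-comm x i j = begin
    (x ^ i) ^ j   ≈⟨ ^-assocʳ x i j ⟩
    x ^ (i ℕ.* j) ≡⟨ ≡.cong (x ^_) (ℕ.*-comm i j) ⟩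
    x ^ (j ℕ.* i) ≈⟨ ^-assocʳ x j i ⟨
    (x ^ j) ^ i   ∎

  -- The exponent is a parameter because two instances are needed: σ with m = k and τ with m = ℓ.
  module Frobenius (m : ℕ) where
    φ : Carrier → Carrier
    φ x = x ^ (p ℕ.^ m)

    φ-cong : ∀ {x y} → x ≈ y → φ x ≈ φ y
    φ-cong = ^-congˡ (p ℕ.^ m)

    φ-+ : ∀ x y → φ (x + y) ≈ φ x + φ y
    φ-+ = ^p^m-distrib-+ commutativeRing p-prime p·1≈0 m

    φ-* : ∀ x y → φ (x * y) ≈ φ x * φ y
    φ-* x y = ^-distrib-* x y (p ℕ.^ m)

    φ-0 : φ 0# ≈ 0#
    φ-0 = x+x≈x⇒x≈0 _ (trans (sym (φ-+ 0# 0#)) (φ-cong (+-identityˡ 0#)))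

    φ-1 : φ 1# ≈ 1#
    φ-1 = 1^m≈1 (p ℕ.^ m)

    φ-neg : ∀ x → φ (- x) ≈ - φ x
    φ-neg x = inverseʳ-unique (φ x) (φ (- x))
      (trans (sym (φ-+ x (- x))) (trans (φ-cong (-‿inverseʳ x)) φ-0))

    φ-- : ∀ x y → φ (x - y) ≈ φ x - φ y
    φ-- x y = trans (φ-+ x (- y)) (+-congˡ (φ-neg y))

    φ-injective : ∀ {x y} → φ x ≈ φ y → x ≈ y
    φ-injective {x} {y} eq = x∙y⁻¹≈ε⇒x≈y x y (x^m≈0⇒x≈0 (p ℕ.^ m)
      (trans (φ-- x y) (x≈y⇒x∙y⁻¹≈ε eq)))

  open Frobenius k public using () renaming
    (φ to σ; φ-cong to σ-cong; φ-+ to σ-+; φ-* to σ-*; φ-- to σ--; φ-0 to σ-0; φ-1 to σ-1)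
  open Frobenius ℓ public using () renaming
    (φ to τ; φ-cong to τ-cong; φ-+ to τ-+; φ-injective to τ-injective)

  -- The exponents multiply to q³, the order of the field, and raising to the order is the identity.
  σ³≈id : ∀ x → σ (σ (σ x)) ≈ x
  σ³≈id x = begin
    ((x ^ q) ^ q) ^ q        ≈⟨ ^-assocʳ (x ^ q) q q ⟩
    (x ^ q) ^ (q ℕ.* q)      ≈⟨ ^-assocʳ x q (q ℕ.* q) ⟩
    x ^ (q ℕ.* (q ℕ.* q))    ≡⟨ ≡.cong (λ m → x ^ (q ℕ.* (q ℕ.* m))) (ℕ.*-identityʳ q) ⟨
    x ^ (q ℕ.^ 3)            ≡⟨ ≡.cong (x ^_) order≡q³ ⟨
    x ^ suc n                ≈⟨ x^order≈x x ⟩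
    x                        ∎

  σσ≈^q² : ∀ x → σ (σ x) ≈ x ^ (q ℕ.^ 2)
  σσ≈^q² x = begin
    (x ^ q) ^ q          ≈⟨ ^-assocʳ x q q ⟩
    x ^ (q ℕ.* q)        ≡⟨ ≡.cong (λ m → x ^ (q ℕ.* m)) (ℕ.*-identityʳ q) ⟨
    x ^ (q ℕ.^ 2)        ∎

  -- The difference operator, the trace and the fixed field K of σ.

  D Tr : Carrier → Carrier
  D x = σ x - x
  Tr x = σ (σ x) + σ x + x

  Fixed : Carrier → Set ℓ₁
  Fixed x = σ x ≈ x

  D-cong : ∀ {x y} → x ≈ y → D x ≈ D y
  D-cong x≈y = +-cong (σ-cong x≈y) (-‿cong x≈y)

  Tr-cong : ∀ {x y} → x ≈ y → Tr x ≈ Tr y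
  Tr-cong x≈y = +-cong (+-cong (σ-cong (σ-cong x≈y)) (σ-cong x≈y)) x≈y

  σσ-+ : ∀ x y → σ (σ (x + y)) ≈ σ (σ x) + σ (σ y)
  σσ-+ x y = trans (σ-cong (σ-+ x y)) (σ-+ (σ x) (σ y))

  σσ-* : ∀ x y → σ (σ (x * y)) ≈ σ (σ x) * σ (σ y)
  σσ-* x y = trans (σ-cong (σ-* x y)) (σ-* (σ x) (σ y))

  Tr-+ : ∀ x y → Tr (x + y) ≈ Tr x + Tr y
  Tr-+ x y = trans (+-congʳ (+-cong (σσ-+ x y) (σ-+ x y)))
    (solve 6 (λ x₂ y₂ x₁ y₁ x y → ((x₂ :+ y₂) :+ (x₁ :+ y₁)) :+ (x :+ y) :=
      ((x₂ :+ x₁) :+ x) :+ ((y₂ :+ y₁) :+ y)) refl _ _ _ _ _ _)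

  -- As σ³ is the identity, σ permutes the three summands cyclically.
  Fixed-Tr : ∀ x → Fixed (Tr x)
  Fixed-Tr x = begin
    σ (Tr x)                              ≈⟨ trans (σ-+ _ _) (+-congʳ (σ-+ _ _)) ⟩
    σ (σ (σ x)) + σ (σ x) + σ x           ≈⟨ +-congʳ (+-congʳ (σ³≈id x)) ⟩
    x + σ (σ x) + σ x                     ≈⟨ solve 3 (λ x₀ x₁ x₂ → (x₀ :+ x₂) :+ x₁ := (x₂ :+ x₁) :+ x₀) refl _ _ _ ⟩
    Tr x                                  ∎

  Fixed-τ : ∀ {x} → Fixed x → Fixed (τ x)
  Fixed-τ {x} σx≈x = trans (^-comm x Q q) (τ-cong σx≈x)

  Fixed-- : ∀ {x y} → Fixed x → Fixed y → Fixed (x - y)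
  Fixed-- σx≈x σy≈y = trans (σ-- _ _) (+-cong σx≈x (-‿cong σy≈y))

  Fixed⇒Tr≈three* : ∀ {x} → Fixed x → Tr x ≈ three * x
  Fixed⇒Tr≈three* {x} σx≈x = trans
    (+-congʳ (+-cong (trans (σ-cong σx≈x) σx≈x) σx≈x))
    (solve 1 (λ x → (x :+ x) :+ x := ((con (ℤ.+ 1) :+ con (ℤ.+ 1)) :+ con (ℤ.+ 1)) :* x) refl x)

  Tr-*-Fixed : ∀ x {b} → Fixed b → Tr (x * b) ≈ Tr x * b
  Tr-*-Fixed x {b} σb≈b = begin
    Tr (x * b)                                 ≈⟨ +-congʳ (+-cong (σσ-* x b) (σ-* x b)) ⟩
    σ (σ x) * σ (σ b) + σ x * σ b + x * b      ≈⟨ +-congʳ (+-cong (*-congˡ (trans (σ-cong σb≈b) σb≈b)) (*-congˡ σb≈b)) ⟩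
    σ (σ x) * b + σ x * b + x * b              ≈⟨ solve 4 (λ x₂ x₁ x b →
      (x₂ :* b :+ x₁ :* b) :+ x :* b := ((x₂ :+ x₁) :+ x) :* b) refl _ _ _ _ ⟩
    Tr x * b                                   ∎

  -- The sum of the three conjugate differences telescopes.
  Tr-D≈0 : ∀ x → Tr (D x) ≈ 0#
  Tr-D≈0 x = begin
    Tr (D x)                                              ≈⟨ +-congʳ (+-cong
      (trans (σ-cong (σ-- _ _)) (σ-- _ _)) (σ-- _ _)) ⟩
    (σ (σ (σ x)) - σ (σ x)) + (σ (σ x) - σ x) + D x       ≈⟨ +-congʳ (+-congʳ (+-congʳ (σ³≈id x))) ⟩
    (x - σ (σ x)) + (σ (σ x) - σ x) + (σ x - x)           ≈⟨ solve 3 (λ x₀ x₁ x₂ →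
      ((x₀ :- x₂) :+ (x₂ :- x₁)) :+ (x₁ :- x₀) := con (ℤ.+ 0)) refl _ _ _ ⟩
    0#                                                    ∎

  D-+-Fixed : ∀ x {u} → Fixed u → D (x + u) ≈ D x
  D-+-Fixed x {u} σu≈u = trans (+-congʳ (trans (σ-+ x u) (+-congˡ σu≈u)))
    (solve 3 (λ x₁ x u → (x₁ :+ u) :- (x :+ u) := x₁ :- x) refl _ _ _)

  D-*-Fixed : ∀ {b} x → Fixed b → D (b * x) ≈ b * D x
  D-*-Fixed {b} x σb≈b = trans (+-congʳ (trans (σ-* b x) (*-congʳ σb≈b)))
    (solve 3 (λ b x₁ x → b :* x₁ :- b :* x := b :* (x₁ :- x)) refl _ _ _)

  -- The map induced by f, and what its injectivity or surjectivity forces.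

  module _ (c : Carrier) where

    -- The last three terms of f are the conjugates of `c * τ x`, hence collected into one trace.
    g : Carrier → Carrier
    g x = D x ^ 3 + Tr (c * τ x)

    eval-fPoly : ∀ x → eval (fPoly q Q c) x ≈ g x
    eval-fPoly x = begin
      eval (fPoly q Q c) x
        ≈⟨ eval-+ᴾ ((cube +ᴾ c₂) +ᴾ c₁) c₀ x ⟩
      eval ((cube +ᴾ c₂) +ᴾ c₁) x + eval c₀ x
        ≈⟨ +-cong (trans (eval-+ᴾ (cube +ᴾ c₂) c₁ x) (+-congʳ (eval-+ᴾ cube c₂ x))) (eval-X^ c Q x) ⟩
      ((eval cube x + eval c₂ x) + eval c₁ x) + c * τ x
        ≈⟨ +-congʳ (+-cong (+-cong eval-cube eval-c₂) eval-c₁) ⟩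
      ((D x ^ 3 + σ (σ (c * τ x))) + σ (c * τ x)) + c * τ x
        ≈⟨ solve 4 (λ s t u v → ((s :+ t) :+ u) :+ v := s :+ ((t :+ u) :+ v)) refl _ _ _ _ ⟩
      g x ∎
      where
      X^q-X = 1# X^ q -ᴾ 1# X^ 1
      cube = X^q-X ^ᴾ 3
      c₂ = (c ^ (q ℕ.^ 2)) X^ (q ℕ.^ 2 ℕ.* Q)
      c₁ = (c ^ q) X^ (q ℕ.* Q)
      c₀ = c X^ Q

      eval-cube : eval cube x ≈ D x ^ 3
      eval-cube = trans (eval-^ᴾ X^q-X 3 x) (^-congˡ 3 (trans (eval--ᴾ (1# X^ q) (1# X^ 1) x)
        (+-cong (trans (eval-X^ 1# q x) (*-identityˡ _))
                (-‿cong (trans (eval-X^ 1# 1 x) (trans (*-identityˡ _) (*-identityʳ x)))))))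

      *-^-assoc : ∀ m → c ^ m * x ^ (m ℕ.* Q) ≈ (c * τ x) ^ m
      *-^-assoc m = begin
        c ^ m * x ^ (m ℕ.* Q)    ≈⟨ *-congˡ (^-assocʳ x m Q) ⟨
        c ^ m * (x ^ m) ^ Q      ≈⟨ *-congˡ (^-comm x m Q) ⟩
        c ^ m * (x ^ Q) ^ m      ≈⟨ ^-distrib-* c (x ^ Q) m ⟨
        (c * τ x) ^ m            ∎

      eval-c₁ : eval c₁ x ≈ σ (c * τ x)
      eval-c₁ = trans (eval-X^ (c ^ q) (q ℕ.* Q) x) (*-^-assoc q)

      eval-c₂ : eval c₂ x ≈ σ (σ (c * τ x))
      eval-c₂ = trans (eval-X^ (c ^ (q ℕ.^ 2)) (q ℕ.^ 2 ℕ.* Q) x)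
        (trans (*-^-assoc (q ℕ.^ 2)) (sym (σσ≈^q² _)))

    g-cong : ∀ {x y} → x ≈ y → g x ≈ g y
    g-cong x≈y = +-cong (^-congˡ 3 (D-cong x≈y)) (Tr-cong (*-congˡ (τ-cong x≈y)))

    -- D does not see translation by K, while the trace is additive and K-linear, and `τ u` stays in
    -- K.
    g-+-Fixed : ∀ x {u} → Fixed u → g (x + u) ≈ g x + Tr c * τ u
    g-+-Fixed x {u} σu≈u = begin
      D (x + u) ^ 3 + Tr (c * τ (x + u))               ≈⟨ +-cong (^-congˡ 3 (D-+-Fixed x σu≈u))
        (Tr-cong (trans (*-congˡ (τ-+ x u)) (distribˡ c _ _))) ⟩
      D x ^ 3 + Tr (c * τ x + c * τ u)                 ≈⟨ +-congˡ (trans (Tr-+ _ _) (+-congˡ (Tr-*-Fixed c (Fixed-τ σu≈u)))) ⟩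
      D x ^ 3 + (Tr (c * τ x) + Tr c * τ u)            ≈⟨ +-assoc _ _ _ ⟨
      g x + Tr c * τ u                                 ∎

    -- If the trace were 0, then g would take the same value at 0 and at 1, since 1 lies in K.
    injective⇒Tr≉0 : Injective _≈_ _≈_ g → Tr c ≉ 0#
    injective⇒Tr≉0 g-inj Tr≈0 = 1≉0 (trans (sym (+-identityˡ 1#)) (g-inj (begin
      g (0# + 1#)          ≈⟨ g-+-Fixed 0# σ-1 ⟩
      g 0# + Tr c * τ 1#   ≈⟨ +-congˡ (trans (*-congʳ Tr≈0) (zeroˡ _)) ⟩
      g 0# + 0#            ≈⟨ +-identityʳ _ ⟩
      g 0#                 ∎)))

    -- In characteristic 3 the cube of an element of trace 0 has trace 0, and so
    -- has every fixed element; hence the values of g all have trace 0.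
    three≈0⇒Tr-g≈0 : three ≈ 0# → ∀ x → Tr (g x) ≈ 0#
    three≈0⇒Tr-g≈0 three≈0 x = begin
      Tr (y ^ 3 + t)                                  ≈⟨ Tr-+ _ _ ⟩
      Tr (y ^ 3) + Tr t                               ≈⟨ +-cong (+-congʳ (+-cong σσ-cube (^-comm y 3 q)))
        (Fixed⇒Tr≈three* (Fixed-Tr _)) ⟩
      -- This is a³ + b³ + c³ = (a + b + c)(a² + b² + c² - ab - bc - ca) + 3abc, whose first factor
      -- is the trace.
      (σ (σ y) ^ 3 + σ y ^ 3 + y ^ 3) + three * t     ≈⟨ +-congʳ (solve 3 (λ a b c →
        ((a :^ 3) :+ (b :^ 3)) :+ (c :^ 3) :=
        ((a :+ b) :+ c) :* ((((((a :* a) :+ (b :* b)) :+ (c :* c)) :- (a :* b)) :- (b :* c)) :- (c :* a))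
          :+ ((con (ℤ.+ 1) :+ con (ℤ.+ 1)) :+ con (ℤ.+ 1)) :* ((a :* b) :* c)) refl (σ (σ y)) (σ y) y) ⟩
      (Tr y * _ + three * _) + three * t              ≈⟨ +-cong (+-cong (*-congʳ (Tr-D≈0 x)) (*-congʳ three≈0)) (*-congʳ three≈0) ⟩
      (0# * _ + 0# * _) + 0# * t                      ≈⟨ +-cong (+-cong (zeroˡ _) (zeroˡ _)) (zeroˡ _) ⟩
      (0# + 0#) + 0#                                  ≈⟨ trans (+-identityʳ _) (+-identityʳ 0#) ⟩
      0#                                              ∎
      where
      y t : Carrier
      y = D x
      t = Tr (c * τ x)
      σσ-cube : σ (σ (y ^ 3)) ≈ σ (σ y) ^ 3
      σσ-cube = trans (σ-cong (^-comm y 3 q)) (^-comm (σ y) 3 q)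

    -- In characteristic 3 all values of g have trace 0, so c itself would be missed.
    surjective∧Tr≉0⇒three≉0 : (∀ y → ∃[ x ] g x ≈ y) → Tr c ≉ 0# → three ≉ 0#
    surjective∧Tr≉0⇒three≉0 g-surj Tr≉0 three≈0 = let (x , gx≈c) = g-surj c in
      Tr≉0 (trans (Tr-cong (sym gx≈c)) (three≈0⇒Tr-g≈0 three≈0 x))

    -- This finds the translation in K that changes g by a prescribed element of K. The map τ is
    -- bijective by finiteness, and the preimage of an element of K lies in K because τ is injective
    -- and commutes with σ.
    Tr*τ-surjective : Tr c ≉ 0# → ∀ {e} → Fixed e → ∃[ u ] Fixed u × Tr c * τ u ≈ e
    Tr*τ-surjective Tr≉0 {e} σe≈e =
      let (t , Tr*t≈1) = inverse (Tr c) Tr≉0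
          (u , τu≈te)  = injective⇒surjective τ τ-cong τ-injective (t * e)
          Tr*te≈e      = trans (sym (*-assoc _ _ _)) (trans (*-congʳ Tr*t≈1) (*-identityˡ e))
      in u , τ-injective (trans (^-comm u q Q) (trans (σ-cong τu≈te)
               (trans (Fixed-te (t * e) Tr*te≈e) (sym τu≈te))))
           , trans (*-congˡ τu≈te) Tr*te≈e
      where
      Fixed-te : ∀ v → Tr c * v ≈ e → Fixed v
      Fixed-te v Tr*v≈e = *-cancelˡ (Tr c) Tr≉0 (begin
        Tr c * σ v        ≈⟨ *-congʳ (Fixed-Tr c) ⟨
        σ (Tr c) * σ v    ≈⟨ σ-* _ _ ⟨
        σ (Tr c * v)      ≈⟨ σ-cong Tr*v≈e ⟩
        σ e               ≈⟨ σe≈e ⟩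
        e                 ≈⟨ Tr*v≈e ⟨
        Tr c * v          ∎)

    -- When the cubes agree, the values of g differ by an element of K. A translation of x′ by some
    -- u in K makes up the difference, so x′ + u = x by injectivity, and D ignores u.
    D³-determines-D : Injective _≈_ _≈_ g → ∀ x x′ → D x ^ 3 ≈ D x′ ^ 3 → D x ≈ D x′
    D³-determines-D g-inj x x′ D³≈ =
      let (u , σu≈u , Tr*τu≈e) = Tr*τ-surjective (injective⇒Tr≉0 g-inj)
                                   (Fixed-- (Fixed-Tr (c * τ x)) (Fixed-Tr (c * τ x′)))
      in sym (trans (sym (D-+-Fixed x′ σu≈u)) (D-cong (g-inj (begin
        g (x′ + u)                                                  ≈⟨ g-+-Fixed x′ σu≈u ⟩
        g x′ + Tr c * τ u                                           ≈⟨ +-cong (+-congʳ (sym D³≈)) Tr*τu≈e ⟩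
        (D x ^ 3 + Tr (c * τ x′)) + (Tr (c * τ x) - Tr (c * τ x′))  ≈⟨ solve 3 (λ s t t′ →
          (s :+ t′) :+ (t :- t′) := s :+ t) refl _ _ _ ⟩
        g x                                                         ∎))))

  -- Exclusion of the residues 0 and 1 of q modulo 3.

  3·1≈three : 3 · 1# ≈ three
  3·1≈three = solve 0 (con (ℤ.+ 1) :+ (con (ℤ.+ 1) :+ (con (ℤ.+ 1) :+ con (ℤ.+ 0))) :=
    (con (ℤ.+ 1) :+ con (ℤ.+ 1)) :+ con (ℤ.+ 1)) refl

  -- Since q is a power of p, divisibility by 3 means p = 3, the characteristic.
  3∣q⇒three≈0 : 3 ∣ q → three ≈ 0#
  3∣q⇒three≈0 3∣q = begin
    three    ≈⟨ 3·1≈three ⟨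
    3 · 1#   ≡⟨ ≡.cong (_· 1#) (prime∣prime^⇒≡ p-prime (toWitness {a? = prime? 3} _) k 3∣q) ⟩
    p · 1#   ≈⟨ p·1≈0 ⟩
    0#       ∎

  module _ {j : ℕ} (q≡1+3j : q ≡ 1 ℕ.+ j ℕ.* 3) (0<j : 0 ℕ.< j) where

    private
      -- One third of n = q³ - 1, the order of the multiplicative group, obtained by expanding (1 +
      -- 3j)³.
      M : ℕ
      M = j ℕ.* (3 ℕ.+ 9 ℕ.* j ℕ.+ 9 ℕ.* (j ℕ.* j))

      instance
        j≢0 : ℕ.NonZero j
        j≢0 = ℕ.>-nonZero 0<j

      j<M : j ℕ.< M
      j<M = ℕ.m<m*n j _ (ℕ.s<s ℕ.z<s)

      n≡M*3 : n ≡ M ℕ.* 3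
      n≡M*3 = ℕ.suc-injective (≡.trans order≡q³ (≡.trans (≡.cong (ℕ._^ 3) q≡1+3j)
        ([1+3j]³≡ j)))

      0<M : 0 ℕ.< M
      0<M = ℕ.<-trans 0<j j<M

      instance
        M≢0 : ℕ.NonZero M
        M≢0 = ℕ.>-nonZero 0<M

      M<n : M ℕ.< n
      M<n = ≡.subst (M ℕ.<_) (≡.sym n≡M*3) (ℕ.m<m*n M 3 (ℕ.s<s ℕ.z<s))

      3j<n : j ℕ.* 3 ℕ.< n
      3j<n = ≡.subst (j ℕ.* 3 ℕ.<_) (≡.sym n≡M*3) (ℕ.*-monoˡ-< 3 j<M)

    -- A nonzero element of K satisfies x^(q-1) = 1, but q - 1 = 3j is below n, so some nonzero x
    -- fails this.
    ∃-¬Fixed : ∃[ x ] ¬ Fixed x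
    ∃-¬Fixed = let (x , x≉0 , neq) = ∃x^m≉1 (j ℕ.* 3) (ℕ.≤-trans 0<j (ℕ.m≤m*n j 3)) 3j<n in
      x , λ σx≈x → neq (*-cancelˡ x x≉0 (begin
        x ^ suc (j ℕ.* 3)  ≡⟨ ≡.cong (x ^_) q≡1+3j ⟨
        σ x                ≈⟨ σx≈x ⟩
        x                  ≈⟨ *-identityʳ x ⟨
        x * 1#             ∎))

    -- Since M is below n, some nonzero x has x^M ≠ 1, and its cube is x^n = 1. A cube root of unity
    -- lies in K because q is 1 modulo 3.
    ∃-Fixed-cube-root : ∃[ ω ] Fixed ω × ω ^ 3 ≈ 1# × ω ≉ 1#
    ∃-Fixed-cube-root = let (x , x≉0 , x^M≉1) = ∃x^m≉1 M 0<M M<n in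
      x ^ M , Fixed-x^M (cube x≉0) , cube x≉0 , x^M≉1
      where
      cube : ∀ {x} → x ≉ 0# → (x ^ M) ^ 3 ≈ 1#
      cube {x} x≉0 = begin
        (x ^ M) ^ 3     ≈⟨ ^-assocʳ x M 3 ⟩
        x ^ (M ℕ.* 3)   ≡⟨ ≡.cong (x ^_) n≡M*3 ⟨
        x ^ n           ≈⟨ x≉0⇒x^n≈1 x x≉0 ⟩
        1#              ∎
      Fixed-x^M : ∀ {ω} → ω ^ 3 ≈ 1# → Fixed ω
      Fixed-x^M {ω} ω³≈1 = begin
        σ ω                   ≡⟨ ≡.cong (ω ^_) q≡1+3j ⟩
        ω * ω ^ (j ℕ.* 3)     ≈⟨ *-congˡ (trans (sym (^-assocʳ ω j 3)) (^-comm ω j 3)) ⟩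
        ω * (ω ^ 3) ^ j       ≈⟨ *-congˡ (trans (^-congˡ j ω³≈1) (1^m≈1 j)) ⟩
        ω * 1#                ≈⟨ *-identityʳ ω ⟩
        ω                     ∎

    -- D is K-linear, so x and ω x have the same cube of D. Injectivity would give ω D x = D x with
    -- D x ≠ 0, hence ω = 1.
    q≡1+3j⇒¬injective : ∀ c → ¬ Injective _≈_ _≈_ (g c)
    q≡1+3j⇒¬injective c g-inj =
      let (x , ¬σx≈x)              = ∃-¬Fixed
          (ω , σω≈ω , ω³≈1 , ω≉1) = ∃-Fixed-cube-root
          ωDx≈Dx : ω * D x ≈ D x
          ωDx≈Dx = trans (sym (D-*-Fixed x σω≈ω)) (sym (D³-determines-D c g-inj x (ω * x) (begin
            D x ^ 3              ≈⟨ *-identityˡ _ ⟨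
            1# * D x ^ 3         ≈⟨ *-congʳ ω³≈1 ⟨
            ω ^ 3 * D x ^ 3      ≈⟨ ^-distrib-* ω (D x) 3 ⟨
            (ω * D x) ^ 3        ≈⟨ ^-congˡ 3 (D-*-Fixed x σω≈ω) ⟨
            D (ω * x) ^ 3        ∎)))
      in ω≉1 (*-cancelˡ (D x) (¬σx≈x ∘ x∙y⁻¹≈ε⇒x≈y (σ x) x) (begin
            D x * ω    ≈⟨ *-comm _ _ ⟩
            ω * D x    ≈⟨ ωDx≈Dx ⟩
            D x        ≈⟨ *-identityʳ _ ⟨
            D x * 1#   ∎))

  -- The quadratic form N on elements of trace zero.

  N : Carrier → Carrier
  N y = y * y + y * σ y + σ y * σ y

  -- N is the cofactor of σ y - y in the factorisation of a difference of cubes.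
  D*N : ∀ y → D y * N y ≈ σ y ^ 3 - y ^ 3
  D*N y = solve 2 (λ y y₁ → (y₁ :- y) :* ((y :* y :+ y :* y₁) :+ y₁ :* y₁) := (y₁ :^ 3) :- (y :^ 3)) refl y (σ y)

  N-cong : ∀ {x y} → x ≈ y → N x ≈ N y
  N-cong x≈y = +-cong (+-cong (*-cong x≈y x≈y) (*-cong x≈y (σ-cong x≈y))) (*-cong (σ-cong x≈y) (σ-cong x≈y))

  N-*-Fixed : ∀ {b} y → Fixed b → N (b * y) ≈ b * b * N y
  N-*-Fixed {b} y σb≈b = trans
    (+-cong (+-congˡ (*-congˡ σ[by])) (*-cong σ[by] σ[by]))
    (solve 3 (λ b y y₁ →
      ((b :* y) :* (b :* y) :+ (b :* y) :* (b :* y₁)) :+ (b :* y₁) :* (b :* y₁)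
        := (b :* b) :* ((y :* y :+ y :* y₁) :+ y₁ :* y₁)) refl b y (σ y))
    where
    σ[by] : σ (b * y) ≈ b * σ y
    σ[by] = trans (σ-* b y) (*-congʳ σb≈b)

  -- The difference `σ (N y) - N y` factors as `Tr y` times `σ (σ y) - y`.
  Tr≈0⇒Fixed-N : ∀ {y} → Tr y ≈ 0# → Fixed (N y)
  Tr≈0⇒Fixed-N {y} Tr≈0 = begin
    σ (N y)                                          ≈⟨ trans (σ-+ _ _) (+-cong
      (trans (σ-+ _ _) (+-cong (σ-* _ _) (σ-* _ _))) (σ-* _ _)) ⟩
    σ y * σ y + σ y * σ (σ y) + σ (σ y) * σ (σ y)    ≈⟨ solve 3 (λ y y₁ y₂ →
      (y₁ :* y₁ :+ y₁ :* y₂) :+ y₂ :* y₂ :=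
      ((y :* y :+ y :* y₁) :+ y₁ :* y₁) :+ ((y₂ :+ y₁) :+ y) :* (y₂ :- y)) refl y (σ y) (σ (σ y)) ⟩
    N y + Tr y * (σ (σ y) - y)                       ≈⟨ +-congˡ (trans (*-congʳ Tr≈0) (zeroˡ _)) ⟩
    N y + 0#                                         ≈⟨ +-identityʳ _ ⟩
    N y                                              ∎

  -- The residue 2 of q modulo 3: injectivity of g.

  module _ {j : ℕ} (q≡2+3j : q ≡ 2 ℕ.+ j ℕ.* 3) where

    -- If 3 = 0 in the field, then 0 = `q · 1#` = 2 + 3j = 2, whence 1 = 3 - 2 = 0.
    three≉0 : three ≉ 0#
    three≉0 three≈0 = 1≉0 (begin
      1#                                      ≈⟨ solve 0 (con (ℤ.+ 1) :=
        ((con (ℤ.+ 1) :+ con (ℤ.+ 1)) :+ con (ℤ.+ 1)) :- (con (ℤ.+ 1) :+ (con (ℤ.+ 1) :+ con (ℤ.+ 0)))) refl ⟩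
      three - (1# + (1# + 0#))                ≈⟨ +-cong three≈0 (-‿cong two≈0) ⟩
      0# - 0#                                 ≈⟨ -‿inverseʳ 0# ⟩
      0#                                      ∎)
      where
      two≈0 : 1# + (1# + 0#) ≈ 0#
      two≈0 = begin
        1# + (1# + 0#)                        ≈⟨ +-congˡ (+-congˡ (∣⇒·≈0 commutativeRing
          (trans 3·1≈three three≈0) (divides j ≡.refl) 1#)) ⟨
        (2 ℕ.+ j ℕ.* 3) · 1#                  ≡⟨ ≡.cong (_· 1#) q≡2+3j ⟨
        q · 1#                                ≈⟨ q·1≈0 ⟩
        0#                                    ∎

    -- Writing σ x as x² times a power of x³ allows σ to be compared on elements with equal cubes.
    σ≈ : ∀ x → σ x ≈ x * (x * (x ^ 3) ^ j)
    σ≈ x = begin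
      x ^ q                        ≡⟨ ≡.cong (x ^_) q≡2+3j ⟩
      x * (x * x ^ (j ℕ.* 3))      ≈⟨ *-congˡ (*-congˡ (trans (sym (^-assocʳ x j 3)) (^-comm x j 3))) ⟩
      x * (x * (x ^ 3) ^ j)        ∎

    -- On K the trace is multiplication by 3, which is nonzero here.
    Fixed∧Tr≈0⇒≈0 : ∀ {x} → Fixed x → Tr x ≈ 0# → x ≈ 0#
    Fixed∧Tr≈0⇒≈0 σx≈x Tr≈0 = xy≈0⇒y≈0 three≉0 (trans (sym (Fixed⇒Tr≈three* σx≈x)) Tr≈0)

    -- For nonzero x in K, x^(q-1) = 1 says that x is the inverse of the j-th power of x³, so x is
    -- determined by its cube.
    Fixed-cube-injective : ∀ {a b} → Fixed a → Fixed b → a ≉ 0# → b ≉ 0# → a ^ 3 ≈ b ^ 3 → a ≈ b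
    Fixed-cube-injective {a} {b} σa≈a σb≈b a≉0 b≉0 a³≈b³ = begin
      a                          ≈⟨ *-identityʳ a ⟨
      a * 1#                     ≈⟨ *-congˡ (x*[x³]^j≈1 σb≈b b≉0) ⟨
      a * (b * (b ^ 3) ^ j)      ≈⟨ *-congˡ (*-congˡ (^-congˡ j a³≈b³)) ⟨
      a * (b * (a ^ 3) ^ j)      ≈⟨ solve 3 (λ a b e → a :* (b :* e) := b :* (a :* e)) refl _ _ _ ⟩
      b * (a * (a ^ 3) ^ j)      ≈⟨ *-congˡ (x*[x³]^j≈1 σa≈a a≉0) ⟩
      b * 1#                     ≈⟨ *-identityʳ b ⟩
      b                          ∎
      where
      x*[x³]^j≈1 : ∀ {x} → Fixed x → x ≉ 0# → x * (x ^ 3) ^ j ≈ 1#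
      x*[x³]^j≈1 {x} σx≈x x≉0 = *-cancelˡ x x≉0 (trans (sym (σ≈ x)) (trans σx≈x (sym (*-identityʳ x))))

    -- If N y = 0 then y and σ y have the same cube, so by σ≈ the map σ multiplies
    -- both by the same power of that cube; this makes y, σ y, σ² y all equal.
    N-anisotropic : ∀ {y} → N y ≈ 0# → y ≈ 0#
    N-anisotropic {y} N≈0 with y ≟ 0#
    ... | yes y≈0 = y≈0
    ... | no  y≉0 = contradiction (xy≈0⇒y≈0 y≉0 (xy≈0⇒y≈0 three≉0 three*yy≈0)) y≉0
      where
      y₁³≈y³ : σ y ^ 3 ≈ y ^ 3
      y₁³≈y³ = x∙y⁻¹≈ε⇒x≈y _ _ (trans (sym (D*N y)) (trans (*-congˡ N≈0) (zeroʳ _)))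
      e : Carrier
      e = (y ^ 3) ^ j
      y₂≈ : σ (σ y) ≈ σ y * (σ y * e)
      y₂≈ = trans (σ≈ (σ y)) (*-congˡ (*-congˡ (^-congˡ j y₁³≈y³)))
      yyy≈yyy₂ : y * (y * y) ≈ y * (y * σ (σ y))
      yyy≈yyy₂ = begin
        y * (y * y)                        ≈⟨ *-congˡ (*-congˡ (*-identityʳ y)) ⟨
        y ^ 3                              ≈⟨ y₁³≈y³ ⟨
        σ y * (σ y * (σ y * 1#))           ≈⟨ *-congʳ (σ≈ y) ⟩
        (y * (y * e)) * (σ y * (σ y * 1#)) ≈⟨ solve 3 (λ y y₁ e →
          (y :* (y :* e)) :* (y₁ :* (y₁ :* con (ℤ.+ 1))) := y :* (y :* (y₁ :* (y₁ :* e)))) refl _ _ _ ⟩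
        y * (y * (σ y * (σ y * e)))        ≈⟨ *-congˡ (*-congˡ y₂≈) ⟨
        y * (y * σ (σ y))                  ∎
      y≈y₂ : y ≈ σ (σ y)
      y≈y₂ = *-cancelˡ y y≉0 (*-cancelˡ y y≉0 yyy≈yyy₂)
      y₁≈y : σ y ≈ y
      y₁≈y = trans (σ-cong y≈y₂) (σ³≈id y)
      -- Once y is fixed by σ, the form N y is just 3 y².
      three*yy≈0 : three * (y * y) ≈ 0#
      three*yy≈0 = begin
        three * (y * y)              ≈⟨ solve 1 (λ y → ((con (ℤ.+ 1) :+ con (ℤ.+ 1)) :+ con (ℤ.+ 1)) :* (y :* y)
          := (y :* y :+ y :* y) :+ y :* y) refl y ⟩
        y * y + y * y + y * y        ≈⟨ +-cong (+-congˡ (*-congˡ y₁≈y)) (*-cong y₁≈y y₁≈y) ⟨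
        N y                          ≈⟨ N≈0 ⟩
        0#                           ∎

    -- One factor vanishes. If it is D y, then y lies in K and has trace 0; if it is N y, the form
    -- is anisotropic.
    D*N≈0⇒≈0 : ∀ {y} → Tr y ≈ 0# → D y * N y ≈ 0# → y ≈ 0#
    D*N≈0⇒≈0 {y} Tr≈0 DN≈0 with D y ≟ 0#
    ... | yes D≈0 = Fixed∧Tr≈0⇒≈0 (x∙y⁻¹≈ε⇒x≈y _ _ D≈0) Tr≈0
    ... | no  D≉0 = N-anisotropic (xy≈0⇒y≈0 D≉0 DN≈0)

    D*N-injective : ∀ {y z} → Tr y ≈ 0# → Tr z ≈ 0# → D y * N y ≈ D z * N z → y ≈ z
    D*N-injective {y} {z} Try≈0 Trz≈0 DN≈ = helper (y ≟ 0#) (z ≟ 0#)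
      where
      σNy : Fixed (N y)
      σNy = Tr≈0⇒Fixed-N Try≈0
      σNz : Fixed (N z)
      σNz = Tr≈0⇒Fixed-N Trz≈0
      w : Carrier
      w = y * N y - z * N z
      -- As N y and N z lie in K, `σ w - w` is the difference of the two sides of the hypothesis.
      Fixed-w : Fixed w
      Fixed-w = x∙y⁻¹≈ε⇒x≈y _ _ (begin
        σ w - w                                               ≈⟨ +-congʳ (trans (σ-- _ _) (+-cong
          (trans (σ-* _ _) (*-congˡ σNy)) (-‿cong (trans (σ-* _ _) (*-congˡ σNz))))) ⟩
        (σ y * N y - σ z * N z) - w                           ≈⟨ solve 6 (λ y₁ y a z₁ z b →
          (y₁ :* a :- z₁ :* b) :- (y :* a :- z :* b) := (y₁ :- y) :* a :- (z₁ :- z) :* b)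
          refl (σ y) y (N y) (σ z) z (N z) ⟩
        D y * N y - D z * N z                                 ≈⟨ x≈y⇒x∙y⁻¹≈ε DN≈ ⟩
        0#                                                    ∎)
      Tr-w : Tr w ≈ 0#
      Tr-w = begin
        Tr w                           ≈⟨ Tr-cong (solve 4 (λ y a z b →
          y :* a :- z :* b := y :* a :+ (:- z) :* b) refl _ _ _ _) ⟩
        Tr (y * N y + (- z) * N z)     ≈⟨ trans (Tr-+ _ _) (+-cong (Tr-*-Fixed y σNy) (Tr-*-Fixed (- z) σNz)) ⟩
        Tr y * N y + Tr (- z) * N z    ≈⟨ +-cong (*-congʳ Try≈0) (*-congʳ Tr[-z]≈0) ⟩
        0# * N y + 0# * N z            ≈⟨ trans (+-cong (zeroˡ _) (zeroˡ _)) (+-identityˡ 0#) ⟩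
        0#                             ∎
        where
        Tr[-z]≈0 : Tr (- z) ≈ 0#
        Tr[-z]≈0 = begin
          Tr (- z)              ≈⟨ +-identityˡ _ ⟨
          0# + Tr (- z)         ≈⟨ +-congʳ Trz≈0 ⟨
          Tr z + Tr (- z)       ≈⟨ Tr-+ z (- z) ⟨
          Tr (z - z)            ≈⟨ Tr-cong (-‿inverseʳ z) ⟩
          Tr 0#                 ≈⟨ Fixed⇒Tr≈three* σ-0 ⟩
          three * 0#            ≈⟨ zeroʳ three ⟩
          0#                    ∎
      yNy≈zNz : y * N y ≈ z * N z
      yNy≈zNz = x∙y⁻¹≈ε⇒x≈y _ _ (Fixed∧Tr≈0⇒≈0 Fixed-w Tr-w)
      -- The scalar N v lies in K and leaves the quadratic form as its square.
      N[Ny*y] : ∀ {v} → Fixed (N v) → N (v * N v) ≈ N v ^ 3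
      N[Ny*y] {v} σNv = begin
        N (v * N v)         ≈⟨ N-cong (*-comm v (N v)) ⟩
        N (N v * v)         ≈⟨ N-*-Fixed v σNv ⟩
        N v * N v * N v     ≈⟨ solve 1 (λ a → (a :* a) :* a := a :^ 3) refl (N v) ⟩
        N v ^ 3             ∎
      -- Zero is treated apart, because recovering N y from its cube and cancelling it are done for
      -- N y ≠ 0.
      helper : Dec (y ≈ 0#) → Dec (z ≈ 0#) → y ≈ z
      helper (yes y≈0) _ = trans y≈0 (sym (D*N≈0⇒≈0 Trz≈0 (begin
        D z * N z    ≈⟨ DN≈ ⟨
        D y * N y    ≈⟨ *-congʳ (D-cong y≈0) ⟩
        D 0# * N y   ≈⟨ *-congʳ (x≈y⇒x∙y⁻¹≈ε σ-0) ⟩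
        0# * N y     ≈⟨ zeroˡ _ ⟩
        0#           ∎)))
      helper (no y≉0) (yes z≈0) = contradiction (D*N≈0⇒≈0 Try≈0 (begin
        D y * N y    ≈⟨ DN≈ ⟩
        D z * N z    ≈⟨ *-congʳ (D-cong z≈0) ⟩
        D 0# * N z   ≈⟨ *-congʳ (x≈y⇒x∙y⁻¹≈ε σ-0) ⟩
        0# * N z     ≈⟨ zeroˡ _ ⟩
        0#           ∎)) y≉0
      -- Applying N to y N y = z N z gives equal cubes of N y and N z, hence N y = N z, which is
      -- then cancelled.
      helper (no y≉0) (no z≉0) = *-cancelˡ (N y) Ny≉0 (begin
        N y * y    ≈⟨ *-comm _ _ ⟩
        y * N y    ≈⟨ yNy≈zNz ⟩
        z * N z    ≈⟨ *-comm _ _ ⟩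
        N z * z    ≈⟨ *-congʳ (Fixed-cube-injective σNy σNz Ny≉0 Nz≉0
          (trans (sym (N[Ny*y] σNy)) (trans (N-cong yNy≈zNz) (N[Ny*y] σNz)))) ⟨
        N y * z    ∎)
        where
        Ny≉0 : N y ≉ 0#
        Ny≉0 = y≉0 ∘ N-anisotropic
        Nz≉0 : N z ≉ 0#
        Nz≉0 = z≉0 ∘ N-anisotropic

    -- The trace term cancels in `σ (g x) - g x`, leaving D (D x) N (D x), so g x determines D x.
    -- Then u = x - x′ lies in K, and translation by u changes g by `Tr c * τ u`, which must be 0.
    g-injective : ∀ {c} → Tr c ≉ 0# → Injective _≈_ _≈_ (g c)
    g-injective {c} Tr≉0 {x} {x′} gx≈gx′ = x∙y⁻¹≈ε⇒x≈y x x′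
      (x^m≈0⇒x≈0 Q (xy≈0⇒y≈0 Tr≉0 Tr*τu≈0))
      where
      y z t t′ u : Carrier
      y = D x
      z = D x′
      t = Tr (c * τ x)
      t′ = Tr (c * τ x′)
      u = x - x′
      σg : ∀ v → σ (g c v) ≈ σ (D v) ^ 3 + Tr (c * τ v)
      σg v = trans (σ-+ _ _) (+-cong (^-comm (D v) 3 q) (Fixed-Tr _))
      D*N≈ : ∀ v → D (D v) * N (D v) ≈ σ (g c v) - g c v
      D*N≈ v = begin
        D (D v) * N (D v)                ≈⟨ D*N (D v) ⟩
        σ (D v) ^ 3 - D v ^ 3            ≈⟨ solve 3 (λ r s t → r :- s := (r :+ t) :- (s :+ t)) refl _ _ (Tr (c * τ v)) ⟩
        (σ (D v) ^ 3 + Tr (c * τ v)) - g c v ≈⟨ +-congʳ (σg v) ⟨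
        σ (g c v) - g c v                ∎
      y≈z : y ≈ z
      y≈z = D*N-injective (Tr-D≈0 x) (Tr-D≈0 x′)
        (trans (D*N≈ x) (trans (D-cong gx≈gx′) (sym (D*N≈ x′))))
      Fixed-u : Fixed u
      Fixed-u = x∙y⁻¹≈ε⇒x≈y _ _ (begin
        σ (x - x′) - (x - x′)         ≈⟨ +-congʳ (σ-- x x′) ⟩
        (σ x - σ x′) - (x - x′)       ≈⟨ solve 4 (λ a b c d → (a :- b) :- (c :- d) := (a :- c) :- (b :- d)) refl _ _ _ _ ⟩
        y - z                         ≈⟨ x≈y⇒x∙y⁻¹≈ε y≈z ⟩
        0#                            ∎)
      Tr*τu≈0 : Tr c * τ u ≈ 0#
      Tr*τu≈0 = begin
        Tr c * τ u                    ≈⟨ solve 2 (λ a b → b := (a :+ b) :- a) refl (g c x′) _ ⟩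
        (g c x′ + Tr c * τ u) - g c x′ ≈⟨ +-congʳ (g-+-Fixed c x′ Fixed-u) ⟨
        g c (x′ + u) - g c x′         ≈⟨ x≈y⇒x∙y⁻¹≈ε (trans (g-cong c
          (solve 2 (λ x x′ → x′ :+ (x :- x′) := x) refl x x′)) gx≈gx′) ⟩
        0#                            ∎

  -- Assembly of both directions of the equivalence.

  g-permutes⇒ : ∀ c → k > 0 → Injective _≈_ _≈_ (g c) → (∀ y → ∃[ x ] g c x ≈ y) → q % 3 ≡ 2 × Tr c ≉ 0#
  g-permutes⇒ c k>0 g-inj g-surj = residue (q % 3) ≡.refl (m%n<n q 3) , Tr≉0
    where
    Tr≉0 : Tr c ≉ 0#
    Tr≉0 = injective⇒Tr≉0 c g-inj
    q≡ : ∀ {r} → q % 3 ≡ r → q ≡ r ℕ.+ q ℕ./ 3 ℕ.* 3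
    q≡ q%3≡r = ≡.trans (m≡m%n+[m/n]*n q 3) (≡.cong (ℕ._+ q ℕ./ 3 ℕ.* 3) q%3≡r)
    -- In residue 1 this makes the quotient j positive: a zero quotient would mean q = 1.
    1<q : 1 ℕ.< q
    1<q = ℕ.≤-trans (ℕ.nonTrivial⇒n>1 p {{prime⇒nonTrivial p-prime}})
      (≡.subst (ℕ._≤ q) (ℕ.^-identityʳ p) (ℕ.^-monoʳ-≤ p {{prime⇒nonZero p-prime}} k>0))
    residue : ∀ r → q % 3 ≡ r → r ℕ.< 3 → q % 3 ≡ 2
    residue 0 q%3≡0 _ = contradiction (3∣q⇒three≈0 (divides (q ℕ./ 3) (q≡ q%3≡0)))
      (surjective∧Tr≉0⇒three≉0 c g-surj Tr≉0)
    residue 1 q%3≡1 _ = ⊥-elim (q≡1+3j⇒¬injective {q ℕ./ 3} (q≡ q%3≡1)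
      (ℕ.n≢0⇒n>0 λ q/3≡0 → ℕ.<-irrefl (≡.sym (≡.trans (q≡ q%3≡1) (≡.cong (λ m → 1 ℕ.+ m ℕ.* 3) q/3≡0))) 1<q)
      c g-inj)
    residue 2 q%3≡2 _ = q%3≡2
    residue (suc (suc (suc _))) _ (ℕ.s≤s (ℕ.s≤s (ℕ.s≤s ())))

  -- Both directions pass between the polynomial and g; in the converse, surjectivity follows from
  -- injectivity by finiteness.
  fPoly-permutes⇔ : ∀ c → k > 0 → FieldNotation.Permutes F (fPoly q Q c) ⇔
                    (q % 3 ≡ 2 × c ^ (q ℕ.^ 2) + c ^ q + c ≉ 0#)
  fPoly-permutes⇔ c k>0 = mk⇔ to from
    where
    f : Carrier → Carrier
    f = eval (fPoly q Q c)
    Tr≈ : Tr c ≈ c ^ (q ℕ.^ 2) + c ^ q + c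
    Tr≈ = +-congʳ (+-congʳ (σσ≈^q² c))
    to : FieldNotation.Permutes F (fPoly q Q c) → q % 3 ≡ 2 × c ^ (q ℕ.^ 2) + c ^ q + c ≉ 0#
    to (f-inj , f-surj) =
      let (q%3≡2 , Tr≉0) = g-permutes⇒ c k>0
            (λ {x} {y} eq → f-inj (trans (eval-fPoly c x) (trans eq (sym (eval-fPoly c y)))))
            (λ y → let (x , hits) = f-surj y in x , trans (sym (eval-fPoly c x)) (hits refl))
      in q%3≡2 , λ eq → Tr≉0 (trans Tr≈ eq)
    from : q % 3 ≡ 2 × c ^ (q ℕ.^ 2) + c ^ q + c ≉ 0# → FieldNotation.Permutes F (fPoly q Q c)
    from (q%3≡2 , Tr≉0) = (λ {x} {y} eq → g-inj (trans (sym (eval-fPoly c x)) (trans eq (eval-fPoly c y))))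
      , λ y → let (x , gx≈y) = injective⇒surjective (g c) (g-cong c) g-inj y in
          x , λ {z} z≈x → trans (eval-fPoly c z) (trans (g-cong c z≈x) gx≈y)
      where
      g-inj : Injective _≈_ _≈_ (g c)
      g-inj = g-injective {q ℕ./ 3} (≡.trans (m≡m%n+[m/n]*n q 3) (≡.cong (ℕ._+ q ℕ./ 3 ℕ.* 3) q%3≡2))
        (λ eq → Tr≉0 (trans (sym Tr≈) eq))

theorem1p8 : ∀ {a ℓ₁ ℓ₂} (p k ℓ : ℕ) → Prime p → k > 0 →
  (F : HeytingField a ℓ₁ ℓ₂) →
  let open FieldNotation F
      q = p ℕ.^ k
      Q = p ℕ.^ ℓ
  in HasOrder (q ℕ.^ 3) → (c : Carrier) →
     Permutes (fPoly q Q c) ⇔ (q % 3 ≡ 2 × c ^ (q ℕ.^ 2) + c ^ q + c ≉ 0#)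
theorem1p8 p k ℓ p-prime k>0 F order c =
  PrimePowerField.fPoly-permutes⇔ F (ℕ.pred (q ℕ.^ 3)) (≡.subst (FieldNotation.HasOrder F) (≡.sym 1+n≡q³) order)
    p k ℓ p-prime 1+n≡q³ c k>0
  where
  q = p ℕ.^ k
  -- The prime p is nonzero, so q³ is a successor, as the description of the field by its n nonzero
  -- elements demands.
  1+n≡q³ : suc (ℕ.pred (q ℕ.^ 3)) ≡ q ℕ.^ 3
  1+n≡q³ = ℕ.suc-pred (q ℕ.^ 3) {{ℕ.m^n≢0 q 3 {{ℕ.m^n≢0 p k {{prime⇒nonZero p-prime}}}}}}
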